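{- Let $t$ be an indeterminate, and let $D_n$ ($n\ge 0$) be the shifted derangement numbers. For every integer $n\ge 0$, $$1+\sum_{k=1}^n \frac{t^{k-1}}{(k+1)!} \left((k+1)D_{k-1} +(t-1)D_{k+1}\right) =\frac{t^n}{(n+1)!}D_{n+1}.$$
   Context: The shifted derangement numbers are defined by $D_0=0$, $D_1=1$ and $D_{n+2}=(n+2)D_{n+1}+(n+2)D_n$ for $n\ge 0$; equivalently $D_n=d_{n+1}$, where $d_m$ is the number of permutations of $m$ letters with no fixed points. Empty sums equal $0$. -}

module Defs where

open import Algebra.Bundles.Raw using (RawRing)
import Algebra.Definitions.RawSemiring as RawSemiringDefs
open import Data.Integer.Base using (+_)
open import Data.List.Base using (List; []; _∷_; map)
open import Data.Nat.Base as ℕ using (ℕ; zero; suc; _!)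
open import Data.Nat.Properties using (_!≢0)
open import Data.Rational.Base as ℚ using (ℚ; 0ℚ; 1ℚ)
open import Level using (0ℓ)
open import Relation.Binary.PropositionalEquality.Core using (_≡_)

-- D n is the number of permutations of n + 1 letters without fixed points.
D : ℕ → ℕ
D zero          = 0
D (suc zero)    = 1
D (suc (suc n)) = (2 ℕ.+ n) ℕ.* D (suc n) ℕ.+ (2 ℕ.+ n) ℕ.* D n

-- Polynomials in one indeterminate t over ℚ, as coefficient lists with the
-- constant term first.  Trailing zeros are allowed, so the equality of
-- polynomials is _≈_ below (equality of all coefficients), not _≡_ of lists.
ℚ[t] : Set
ℚ[t] = List ℚ

coeff : ℚ[t] → ℕ → ℚ
coeff []      _       = 0ℚ
coeff (a ∷ _) zero    = a
coeff (_ ∷ p) (suc i) = coeff p i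

infix  4 _≈_
infixl 6 _+_ _-_
infixl 7 _*_ _·_ _/_!
infix  8 -_

_≈_ : ℚ[t] → ℚ[t] → Set
p ≈ q = ∀ i → coeff p i ≡ coeff q i

_+_ : ℚ[t] → ℚ[t] → ℚ[t]
[]      + q       = q
(a ∷ p) + []      = a ∷ p
(a ∷ p) + (b ∷ q) = (a ℚ.+ b) ∷ (p + q)

-_ : ℚ[t] → ℚ[t]
- p = map ℚ.-_ p

_-_ : ℚ[t] → ℚ[t] → ℚ[t]
p - q = p + (- q)

_·_ : ℚ → ℚ[t] → ℚ[t]
c · p = map (c ℚ.*_) p

-- (a + t p) q = a q + t (p q)
_*_ : ℚ[t] → ℚ[t] → ℚ[t]
[]      * q = []
(a ∷ p) * q = (a · q) + (0ℚ ∷ (p * q))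

0# 1# t : ℚ[t]
0# = []
1# = 1ℚ ∷ []
t  = 0ℚ ∷ 1ℚ ∷ []

ℚ[t]-rawRing : RawRing 0ℓ 0ℓ
ℚ[t]-rawRing = record
  { Carrier = ℚ[t]
  ; _≈_     = _≈_
  ; _+_     = _+_
  ; _*_     = _*_
  ; -_      = -_
  ; 0#      = 0#
  ; 1#      = 1#
  }

open RawSemiringDefs (RawRing.rawSemiring ℚ[t]-rawRing) public using (_^_)

ι : ℕ → ℚ[t]
ι m = (+ m ℚ./ 1) ∷ []

-- The second argument is n itself: p / n ! divides p by the factorial of n.
_/_! : ℚ[t] → ℕ → ℚ[t]
p / n ! = ((+ 1 ℚ./ (n !)) {{n !≢0}}) · p

∑[1≤k≤_]_ : ℕ → (ℕ → ℚ[t]) → ℚ[t]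
∑[1≤k≤ zero  ] f = 0#
∑[1≤k≤ suc n ] f = (∑[1≤k≤ n ] f) + f (suc n)

{-# OPTIONS --safe #-}

-- The sum telescopes: since D (n + 2) = (n + 2) D (n + 1) + (n + 2) D n, the
-- k-th summand is t ^ k D (k + 1) / (k + 1)! - t ^ (k - 1) D k / k!.

module Submission where

open import Defs
open import Data.Nat.Base as ℕ using (ℕ; zero; suc; NonZero; _∸_; _!)
open import Data.Nat.Properties as ℕₚ using (_!≢0)
open import Data.Integer.Base as ℤ using (+_)
import Data.Integer.Properties as ℤₚ
open import Data.List.Base using ([]; _∷_)
open import Data.Rational.Base as ℚ using (ℚ; 0ℚ; 1ℚ; fromℚᵘ; toℚᵘ)
import Data.Rational.Properties as ℚₚ
open import Data.Rational.Solver using (module +-*-Solver)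
open import Data.Rational.Unnormalised.Base as ℚᵘ using (mkℚᵘ; *≡*)
import Data.Rational.Unnormalised.Properties as ℚᵘₚ
open import Relation.Binary.PropositionalEquality
  using (_≡_; refl; sym; trans; cong; cong₂; module ≡-Reasoning)

open +-*-Solver using (solve; con; _:+_; _:*_; _:=_)

-- The recurrence gives `(k+1) D_{k-1} - D_{k+1} = -(k+1) D_k`, and `(k+1) / (k+1)! = 1 / k!`; so
-- each summand is a difference of consecutive right-hand sides, and the leading 1 is the right-hand
-- side at 0. Every product of polynomials that occurs has a factor of degree at most one, so no
-- ring laws for `ℚ[t]` are needed: `coeff-*-constant`, `coeff-*-linear` and `coeff-t*` turn the
-- inductive step `closedForm-step` into an identity between rationals at each coefficient.

-- `toℚᵘ` is injective, additive, and inverse to `fromℚᵘ` up to `≃`. This lets fractions with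
-- variable entries be compared before reduction to lowest terms.
fromℚᵘ-homo-+ : ∀ p q → fromℚᵘ (p ℚᵘ.+ q) ≡ fromℚᵘ p ℚ.+ fromℚᵘ q
fromℚᵘ-homo-+ p q = ℚₚ.toℚᵘ-injective (begin
  toℚᵘ (fromℚᵘ (p ℚᵘ.+ q))                ≈⟨ ℚₚ.toℚᵘ-fromℚᵘ (p ℚᵘ.+ q) ⟩
  p ℚᵘ.+ q                                ≈⟨ ℚᵘₚ.+-cong (ℚₚ.toℚᵘ-fromℚᵘ p) (ℚₚ.toℚᵘ-fromℚᵘ q) ⟨
  toℚᵘ (fromℚᵘ p) ℚᵘ.+ toℚᵘ (fromℚᵘ q)    ≈⟨ ℚₚ.toℚᵘ-homo-+ (fromℚᵘ p) (fromℚᵘ q) ⟨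
  toℚᵘ (fromℚᵘ p ℚ.+ fromℚᵘ q)            ∎)
  where open import Relation.Binary.Reasoning.Setoid ℚᵘₚ.≃-setoid

fromℚᵘ-homo-* : ∀ p q → fromℚᵘ (p ℚᵘ.* q) ≡ fromℚᵘ p ℚ.* fromℚᵘ q
fromℚᵘ-homo-* p q = ℚₚ.toℚᵘ-injective (begin
  toℚᵘ (fromℚᵘ (p ℚᵘ.* q))                ≈⟨ ℚₚ.toℚᵘ-fromℚᵘ (p ℚᵘ.* q) ⟩
  p ℚᵘ.* q                                ≈⟨ ℚᵘₚ.*-cong (ℚₚ.toℚᵘ-fromℚᵘ p) (ℚₚ.toℚᵘ-fromℚᵘ q) ⟨
  toℚᵘ (fromℚᵘ p) ℚᵘ.* toℚᵘ (fromℚᵘ q)    ≈⟨ ℚₚ.toℚᵘ-homo-* (fromℚᵘ p) (fromℚᵘ q) ⟨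
  toℚᵘ (fromℚᵘ p ℚ.* fromℚᵘ q)            ∎)
  where open import Relation.Binary.Reasoning.Setoid ℚᵘₚ.≃-setoid

fromℕ : ℕ → ℚ
fromℕ m = + m ℚ./ 1

fromℕ-homo-+ : ∀ m n → fromℕ (m ℕ.+ n) ≡ fromℕ m ℚ.+ fromℕ n
fromℕ-homo-+ m n = trans
  (cong (ℚ._/ 1) (sym (cong₂ ℤ._+_ (ℤₚ.*-identityʳ (+ m)) (ℤₚ.*-identityʳ (+ n)))))
  (fromℚᵘ-homo-+ (mkℚᵘ (+ m) 0) (mkℚᵘ (+ n) 0))

fromℕ-homo-* : ∀ m n → fromℕ (m ℕ.* n) ≡ fromℕ m ℚ.* fromℕ n
fromℕ-homo-* m n = trans
  (cong (ℚ._/ 1) (ℤₚ.pos-* m n))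
  (fromℚᵘ-homo-* (mkℚᵘ (+ m) 0) (mkℚᵘ (+ n) 0))

1/[m*n]*m≡1/n : ∀ m n .{{_ : NonZero n}} .{{_ : NonZero (m ℕ.* n)}} →
                (+ 1 ℚ./ (m ℕ.* n)) ℚ.* fromℕ m ≡ + 1 ℚ./ n
1/[m*n]*m≡1/n (suc m) (suc n) = trans
  (sym (fromℚᵘ-homo-* 1/mn (mkℚᵘ (+ suc m) 0)))
  (ℚₚ.fromℚᵘ-cong {1/mn ℚᵘ.* mkℚᵘ (+ suc m) 0} {mkℚᵘ (+ 1) n} (*≡* (begin
    (+ 1 ℤ.* + suc m) ℤ.* + suc n        ≡⟨ cong (ℤ._* + suc n) (ℤₚ.*-identityˡ (+ suc m)) ⟩
    + suc m ℤ.* + suc n                  ≡⟨ ℤₚ.pos-* (suc m) (suc n) ⟨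
    + (suc m ℕ.* suc n)                  ≡⟨ cong +_ (ℕₚ.*-identityʳ (suc m ℕ.* suc n)) ⟨
    + (suc m ℕ.* suc n ℕ.* 1)            ≡⟨ ℤₚ.*-identityˡ _ ⟨
    + 1 ℤ.* + (suc m ℕ.* suc n ℕ.* 1)    ∎)))
  where
  open ≡-Reasoning
  -- `mkℚᵘ` stores the denominator minus one; here the denominator is `suc m ℕ.* suc n`.
  1/mn = mkℚᵘ (+ 1) (n ℕ.+ m ℕ.* suc n)

1/_! : ℕ → ℚ
1/ n ! = (+ 1 ℚ./ (n !)) {{n !≢0}}

1/[1+n]!*[1+n]≡1/n! : ∀ n → 1/ suc n ! ℚ.* fromℕ (suc n) ≡ 1/ n !
1/[1+n]!*[1+n]≡1/n! n = 1/[m*n]*m≡1/n (suc n) (n !) {{n !≢0}} {{suc n !≢0}}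

-- The theorem's indices have the form `n ℕ.+ 1`, which is stuck for a variable `n`; commuted to
-- `suc n`, it meets the defining clause of `D`.
D-rec : ∀ n → D (suc (n ℕ.+ 1)) ≡ suc (n ℕ.+ 1) ℕ.* D (n ℕ.+ 1) ℕ.+ suc (n ℕ.+ 1) ℕ.* D n
D-rec n rewrite ℕₚ.+-comm n 1 = refl

coeff-+ : ∀ p q i → coeff (p + q) i ≡ coeff p i ℚ.+ coeff q i
coeff-+ []      q       i       = sym (ℚₚ.+-identityˡ (coeff q i))
coeff-+ (a ∷ p) []      i       = sym (ℚₚ.+-identityʳ (coeff (a ∷ p) i))
coeff-+ (a ∷ p) (b ∷ q) zero    = refl
coeff-+ (a ∷ p) (b ∷ q) (suc i) = coeff-+ p q i

coeff-· : ∀ c p i → coeff (c · p) i ≡ c ℚ.* coeff p i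
coeff-· c []      i       = sym (ℚₚ.*-zeroʳ c)
coeff-· c (a ∷ p) zero    = refl
coeff-· c (a ∷ p) (suc i) = coeff-· c p i

coeff-0∷· : ∀ c p i → coeff (0ℚ ∷ c · p) i ≡ c ℚ.* coeff (0ℚ ∷ p) i
coeff-0∷· c p zero    = sym (ℚₚ.*-zeroʳ c)
coeff-0∷· c p (suc i) = coeff-· c p i

coeff-0∷[] : ∀ i → coeff (0ℚ ∷ []) i ≡ 0ℚ
coeff-0∷[] zero    = refl
coeff-0∷[] (suc i) = refl

coeff-*-constant : ∀ p x i → coeff (p * (x ∷ [])) i ≡ coeff p i ℚ.* x
coeff-*-constant []      x i       = sym (ℚₚ.*-zeroˡ x)
coeff-*-constant (a ∷ p) x zero    = ℚₚ.+-identityʳ (a ℚ.* x)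
coeff-*-constant (a ∷ p) x (suc i) = coeff-*-constant p x i

-- Here `coeff (0ℚ ∷ p) i` plays the part of the coefficient of index `i - 1`, read as zero at
-- `i = 0`. The second factor of a summand reduces to a list of two entries, so this form covers it.
coeff-*-linear : ∀ p x y i →
  coeff (p * (x ∷ y ∷ [])) i ≡ coeff p i ℚ.* x ℚ.+ coeff (0ℚ ∷ p) i ℚ.* y
coeff-*-linear [] x y i rewrite coeff-0∷[] i =
  solve 2 (λ x y → con 0ℚ := con 0ℚ :* x :+ con 0ℚ :* y) refl x y
coeff-*-linear (a ∷ p) x y zero =
  solve 3 (λ a x y → a :* x :+ con 0ℚ := a :* x :+ con 0ℚ :* y) refl a x y
coeff-*-linear (a ∷ p) x y (suc i) = begin
  coeff ((a ℚ.* y ∷ []) + p * (x ∷ y ∷ [])) i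
    ≡⟨ coeff-+ (a ℚ.* y ∷ []) (p * (x ∷ y ∷ [])) i ⟩
  coeff (a ℚ.* y ∷ []) i ℚ.+ coeff (p * (x ∷ y ∷ [])) i
    ≡⟨ cong (coeff (a ℚ.* y ∷ []) i ℚ.+_) (coeff-*-linear p x y i) ⟩
  coeff (a ℚ.* y ∷ []) i ℚ.+ (coeff p i ℚ.* x ℚ.+ coeff (0ℚ ∷ p) i ℚ.* y)
    ≡⟨ regroup i ⟩
  coeff p i ℚ.* x ℚ.+ coeff (a ∷ p) i ℚ.* y
    ∎
  where
  open ≡-Reasoning
  regroup : ∀ i → coeff (a ℚ.* y ∷ []) i ℚ.+ (coeff p i ℚ.* x ℚ.+ coeff (0ℚ ∷ p) i ℚ.* y)
                ≡ coeff p i ℚ.* x ℚ.+ coeff (a ∷ p) i ℚ.* y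
  -- The head `a` of the left factor contributes `a ℚ.* y` to this one coefficient of the tail only.
  regroup zero = solve 4
    (λ a b x y → a :* y :+ (b :* x :+ con 0ℚ :* y) := b :* x :+ a :* y)
    refl a (coeff p 0) x y
  regroup (suc i) = ℚₚ.+-identityˡ _

coeff-t* : ∀ p i → coeff (t * p) i ≡ coeff (0ℚ ∷ p) i
coeff-t* p i = begin
  coeff (0ℚ · p + (0ℚ ∷ (1# * p))) i
    ≡⟨ coeff-+ (0ℚ · p) _ i ⟩
  coeff (0ℚ · p) i ℚ.+ coeff (0ℚ ∷ (1# * p)) i
    ≡⟨ cong₂ ℚ._+_ (trans (coeff-· 0ℚ p i) (ℚₚ.*-zeroˡ (coeff p i))) (shift i) ⟩
  0ℚ ℚ.+ coeff (0ℚ ∷ p) i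
    ≡⟨ ℚₚ.+-identityˡ _ ⟩
  coeff (0ℚ ∷ p) i
    ∎
  where
  open ≡-Reasoning
  shift : ∀ i → coeff (0ℚ ∷ (1# * p)) i ≡ coeff (0ℚ ∷ p) i
  shift zero    = refl
  shift (suc i) = begin
    coeff (1ℚ · p + (0ℚ ∷ [])) i                ≡⟨ coeff-+ (1ℚ · p) (0ℚ ∷ []) i ⟩
    coeff (1ℚ · p) i ℚ.+ coeff (0ℚ ∷ []) i      ≡⟨ cong₂ ℚ._+_ (coeff-· 1ℚ p i) (coeff-0∷[] i) ⟩
    1ℚ ℚ.* coeff p i ℚ.+ 0ℚ                     ≡⟨ ℚₚ.+-identityʳ _ ⟩
    1ℚ ℚ.* coeff p i                            ≡⟨ ℚₚ.*-identityˡ _ ⟩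
    coeff p i                                   ∎

summand : ℕ → ℚ[t]
summand k = (t ^ (k ∸ 1)) / (k ℕ.+ 1) !
          * (ι ((k ℕ.+ 1) ℕ.* D (k ∸ 1)) + (t - 1#) * ι (D (k ℕ.+ 1)))

closedForm : ℕ → ℚ[t]
closedForm n = (t ^ n) / (n ℕ.+ 1) ! * ι (D (n ℕ.+ 1))

-- One telescoping step, in additive form so that the induction can append the summand directly.
closedForm-step : ∀ n → closedForm n + summand (suc n) ≈ closedForm (suc n)
closedForm-step n i = begin
  coeff (closedForm n + summand (suc n)) i
    ≡⟨ coeff-+ (closedForm n) (summand (suc n)) i ⟩
  coeff (closedForm n) i ℚ.+ coeff (summand (suc n)) i
    ≡⟨ cong₂ ℚ._+_ closedForm-coeff summand-coeff ⟩
  c ℚ.* N ℚ.* P ℚ.* e ℚ.+ (c ℚ.* P ℚ.* x ℚ.+ c ℚ.* S ℚ.* y)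
    -- With `f` the value of `D (suc m)`, `x` equals `N d - f = - N e`; hence the terms in `P`
    -- cancel and only the shifted coefficient `S` survives.
    ≡⟨ solve 6 (λ c N P S d e →
         let f = N :* e :+ N :* d in
           c :* N :* P :* e
             :+ (c :* P :* (N :* d :+ (con (ℚ.- 1ℚ) :* f :+ con 0ℚ))
                 :+ c :* S :* (con 1ℚ :* f :+ con 0ℚ))
         := c :* S :* f) refl c N P S d e ⟩
  c ℚ.* S ℚ.* (N ℚ.* e ℚ.+ N ℚ.* d)
    ≡⟨ next-coeff ⟨
  coeff (closedForm (suc n)) i
    ∎
  where
  open ≡-Reasoning
  m = n ℕ.+ 1
  p = t ^ n
  c = 1/ suc m !
  N = fromℕ (suc m)
  P = coeff p i
  S = coeff (0ℚ ∷ p) i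
  d = fromℕ (D n)
  e = fromℕ (D m)
  f = N ℚ.* e ℚ.+ N ℚ.* d
  -- The coefficients, as they compute, of (n + 2) D n + (t - 1) D (n + 2).
  x = N ℚ.* d ℚ.+ ((ℚ.- 1ℚ) ℚ.* f ℚ.+ 0ℚ)
  y = 1ℚ ℚ.* f ℚ.+ 0ℚ

  D≡f : fromℕ (D (suc m)) ≡ f
  D≡f = begin
    fromℕ (D (suc m))                                 ≡⟨ cong fromℕ (D-rec n) ⟩
    fromℕ (suc m ℕ.* D m ℕ.+ suc m ℕ.* D n)           ≡⟨ fromℕ-homo-+ (suc m ℕ.* D m) (suc m ℕ.* D n) ⟩
    fromℕ (suc m ℕ.* D m) ℚ.+ fromℕ (suc m ℕ.* D n)   ≡⟨ cong₂ ℚ._+_ (fromℕ-homo-* (suc m) (D m)) (fromℕ-homo-* (suc m) (D n)) ⟩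
    f                                                 ∎

  closedForm-coeff : coeff (closedForm n) i ≡ c ℚ.* N ℚ.* P ℚ.* e
  closedForm-coeff = begin
    coeff (closedForm n) i           ≡⟨ coeff-*-constant (1/ m ! · p) e i ⟩
    coeff (1/ m ! · p) i ℚ.* e       ≡⟨ cong (ℚ._* e) (coeff-· (1/ m !) p i) ⟩
    -- Everything is put over the common denominator `suc m !`.
    1/ m ! ℚ.* P ℚ.* e               ≡⟨ cong (λ r → r ℚ.* P ℚ.* e) (1/[1+n]!*[1+n]≡1/n! m) ⟨
    c ℚ.* N ℚ.* P ℚ.* e              ∎

  summand-coeff : coeff (summand (suc n)) i ≡ c ℚ.* P ℚ.* x ℚ.+ c ℚ.* S ℚ.* y
  summand-coeff = begin
    coeff (summand (suc n)) i
      ≡⟨ coeff-*-linear (c · p) _ _ i ⟩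
    coeff (c · p) i ℚ.* (fromℕ (suc m ℕ.* D n) ℚ.+ ((ℚ.- 1ℚ) ℚ.* fromℕ (D (suc m)) ℚ.+ 0ℚ))
      ℚ.+ coeff (0ℚ ∷ c · p) i ℚ.* (1ℚ ℚ.* fromℕ (D (suc m)) ℚ.+ 0ℚ)
      ≡⟨ cong₂ ℚ._+_
           (cong₂ ℚ._*_ (coeff-· c p i)
             (cong₂ ℚ._+_ (fromℕ-homo-* (suc m) (D n)) (cong (λ r → (ℚ.- 1ℚ) ℚ.* r ℚ.+ 0ℚ) D≡f)))
           (cong₂ ℚ._*_ (coeff-0∷· c p i) (cong (λ r → 1ℚ ℚ.* r ℚ.+ 0ℚ) D≡f)) ⟩
    c ℚ.* P ℚ.* x ℚ.+ c ℚ.* S ℚ.* y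
      ∎

  next-coeff : coeff (closedForm (suc n)) i ≡ c ℚ.* S ℚ.* f
  next-coeff = begin
    coeff (closedForm (suc n)) i
      ≡⟨ coeff-*-constant (c · (t * p)) _ i ⟩
    coeff (c · (t * p)) i ℚ.* fromℕ (D (suc m))
      ≡⟨ cong₂ ℚ._*_ (trans (coeff-· c (t * p) i) (cong (c ℚ.*_) (coeff-t* p i))) D≡f ⟩
    c ℚ.* S ℚ.* f
      ∎

mainTheorem8 : (n : ℕ) →
    1# + (∑[1≤k≤ n ] λ k → (t ^ (k ∸ 1)) / (k ℕ.+ 1) !
    * (ι ((k ℕ.+ 1) ℕ.* D (k ∸ 1)) + (t - 1#) * ι (D (k ℕ.+ 1))))
    ≈ (t ^ n) / (n ℕ.+ 1) ! * ι (D (n ℕ.+ 1))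
-- The sum is empty and `D 1 = 1`, so both sides evaluate to the same list `1ℚ ∷ []`.
mainTheorem8 zero    i = refl
mainTheorem8 (suc n) i = begin
  coeff (1# + (Σₙ + summand (suc n))) i
    ≡⟨ coeff-+ 1# (Σₙ + summand (suc n)) i ⟩
  coeff 1# i ℚ.+ coeff (Σₙ + summand (suc n)) i
    ≡⟨ cong (coeff 1# i ℚ.+_) (coeff-+ Σₙ (summand (suc n)) i) ⟩
  coeff 1# i ℚ.+ (coeff Σₙ i ℚ.+ coeff (summand (suc n)) i)
    ≡⟨ ℚₚ.+-assoc (coeff 1# i) (coeff Σₙ i) _ ⟨
  coeff 1# i ℚ.+ coeff Σₙ i ℚ.+ coeff (summand (suc n)) i
    -- The induction hypothesis collapses `1# + Σₙ`, leaving a single telescoping step.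
    ≡⟨ cong (ℚ._+ coeff (summand (suc n)) i) (trans (sym (coeff-+ 1# Σₙ i)) (mainTheorem8 n i)) ⟩
  coeff (closedForm n) i ℚ.+ coeff (summand (suc n)) i
    ≡⟨ coeff-+ (closedForm n) (summand (suc n)) i ⟨
  coeff (closedForm n + summand (suc n)) i
    ≡⟨ closedForm-step n i ⟩
  coeff (closedForm (suc n)) i
    ∎
  where
  open ≡-Reasoning
  Σₙ = ∑[1≤k≤ n ] summand
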